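{- If $T^{\prime}$ is a subtree of a tree $T$, then $i_{\operatorname{bn}}(T^{\prime})\leq i_{\operatorname{bn}}(T)$.
   Context: A broadcast on a connected graph $G=(V,E)$ is a function $f:V\to\{0,1,\dots,\operatorname{diam}(G)\}$ with $f(v)\le e(v)$ (the eccentricity of $v$) for all $v$ if $|V|\ge 2$, and $f(v)=1$ if $V=\{v\}$; its cost is $\sigma(f)=\sum_v f(v)$ and $V_f^+=\{v:f(v)>0\}$. A vertex $u$ hears $f$ from $v\in V_f^+$ if $d(u,v)\le f(v)$. A broadcast $f$ is bn-independent if every vertex $x$ that hears $f$ from more than one vertex of $V_f^+$ satisfies $d(x,u)\ge f(u)$ for all $u\in V_f^+$; it is maximal bn-independent if it is bn-independent and there is no bn-independent broadcast $g\ne f$ with $g(v)\ge f(v)$ for all $v$. $i_{\operatorname{bn}}(G)$ denotes the minimum cost of a maximal bn-independent broadcast on $G$. -}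

module Defs where

open import Data.Nat using (ℕ; zero; suc; _+_; _≤_; _<_; _⊔_)
open import Data.Bool using (Bool; true; false; _∨_; _∧_; if_then_else_)
open import Data.Fin using (Fin; zero; suc; inject₁; fromℕ; _≟_)
open import Data.List using (List; map; foldr)
open import Data.Bool.ListAction using (any)
open import Data.Nat.ListAction using (sum)
open import Data.List.Base using (allFin)
open import Data.Product using (Σ; ∃; ∃-syntax; _×_; _,_)
open import Relation.Nullary using (¬_; ⌊_⌋)
open import Relation.Binary.PropositionalEquality using (_≡_; _≢_)
open import Function.Definitions using (Injective)

record Graph (n : ℕ) : Set where
  field
    adj     : Fin n → Fin n → Bool
    adj-sym : ∀ u v → adj u v ≡ adj v u
    adj-irr : ∀ v → adj v v ≡ false
open Graph public

module _ {n : ℕ} (G : Graph n) where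

  data Walk : Fin n → Fin n → ℕ → Set where
    here : ∀ {v} → Walk v v 0
    step : ∀ {u w v k} → adj G u w ≡ true → Walk w v k → Walk u v (suc k)

  Connected : Set
  Connected = ∀ u v → ∃[ k ] Walk u v k

  HasCycle : Set
  HasCycle = ∃[ m ] Σ (Fin (suc (suc (suc m))) → Fin n) λ c →
               Injective _≡_ _≡_ c
             × (∀ (i : Fin (suc (suc m))) → adj G (c (inject₁ i)) (c (suc i)) ≡ true)
             × adj G (c (fromℕ (suc (suc m)))) (c zero) ≡ true

  IsTree : Set
  IsTree = (1 ≤ n) × Connected × ¬ HasCycle

  reach : ℕ → Fin n → Fin n → Bool
  reach zero    u v = ⌊ u ≟ v ⌋
  reach (suc k) u v = reach k u v ∨ any (λ w → reach k u w ∧ adj G w v) (allFin n)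

  private
    search : ℕ → ℕ → Fin n → Fin n → ℕ
    search zero       k u v = k
    search (suc fuel) k u v = if reach k u v then k else search fuel (suc k) u v

  -- Distance d(u,v): length of a shortest u–v walk (for connected graphs
  -- this is < n, so the search over 0..n finds it).
  dist : Fin n → Fin n → ℕ
  dist u v = search n 0 u v

  maxList : List ℕ → ℕ
  maxList = foldr _⊔_ 0

  ecc : Fin n → ℕ
  ecc v = maxList (map (dist v) (allFin n))

  diam : ℕ
  diam = maxList (map ecc (allFin n))

  IsBroadcast : (Fin n → ℕ) → Set
  IsBroadcast f = (n ≡ 1 → ∀ v → f v ≡ 1)
                × (2 ≤ n → ∀ v → f v ≤ diam × f v ≤ ecc v)

  cost : (Fin n → ℕ) → ℕ
  cost f = sum (map f (allFin n))

  Broadcasting : (Fin n → ℕ) → Fin n → Set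
  Broadcasting f v = 0 < f v

  Hears : (Fin n → ℕ) → Fin n → Fin n → Set
  Hears f u v = Broadcasting f v × dist u v ≤ f v

  IsBnIndependent : (Fin n → ℕ) → Set
  IsBnIndependent f =
    IsBroadcast f ×
    (∀ x → (∃[ v ] ∃[ w ] (v ≢ w × Hears f x v × Hears f x w)) →
           ∀ u → Broadcasting f u → f u ≤ dist x u)

  IsMaximalBnIndependent : (Fin n → ℕ) → Set
  IsMaximalBnIndependent f =
    IsBnIndependent f ×
    (∀ g → IsBnIndependent g → (∀ v → f v ≤ g v) → ∀ v → g v ≡ f v)

{-# OPTIONS --safe #-}
-- A bn-independent broadcast on at least two vertices is maximal iff it is dominating and every broadcasting
-- v covers the whole graph or shares a boundary vertex with another broadcaster: otherwise f(v) can be raised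
-- by 1. A tree arises from each subtree by successively adding leaves, so it suffices to delete one leaf ℓ,
-- with neighbour y, without raising the cost. If f(ℓ) = 0 restrict f; if f(ℓ) ≥ 2 replace ℓ by y with strength
-- f(ℓ) − 1, which has the same ball outside ℓ. If f(ℓ) = 1, then y is on the boundary of another broadcaster w;
-- after deletion only w may be unsaturated, and raising f(w) by 1 repairs this at the price saved at ℓ.
module Submission where

open import Defs
open import Data.Bool using (T; true; false; _∧_; if_then_else_)
open import Data.Bool.Properties using (T-≡; T-∧; T-∨)
open import Data.Empty using (⊥-elim)
open import Data.Fin using (Fin; zero; suc; toℕ; fromℕ; fromℕ<; inject₁; _≟_)
open import Data.Fin.Permutation using (permutation)
open import Data.Fin.Properties using (all?; any?; ¬∀⟶∃¬; toℕ<n; toℕ-injective; toℕ-fromℕ; injective⇒≤)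
import Data.Fin.Properties as Fin
open import Data.List using ([]; _∷_; allFin)
import Data.List as List
open import Data.List.Membership.Propositional using (_∈_; lose)
open import Data.List.Membership.Propositional.Properties using (∈-allFin; ∈-map⁺; ∈-map⁻)
open import Data.List.Properties using (map-tabulate)
open import Data.List.Relation.Unary.Any as Any using (here; there)
open import Data.List.Relation.Unary.Any.Properties using (any⁺; any⁻)
open import Data.Nat using (ℕ; zero; suc; _+_; _∸_; _≤_; _<_; z≤n; s≤s; s≤s⁻¹; _≤?_; _<?_; _≤′_; ≤′-reflexive; ≤′-step)
import Data.Nat as ℕ
import Data.Nat.ListAction as ListAction
open import Data.Nat.Properties hiding (_≟_)
open import Data.Product using (∃-syntax; _×_; _,_; proj₁; proj₂)
open import Data.Sum using (_⊎_; inj₁; inj₂)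
open import Data.Vec.Functional using (Vector; updateAt)
open import Data.Vec.Functional.Properties using (updateAt-updates; updateAt-minimal)
open import Function using (_∘_; const)
open import Function.Bundles using (module Equivalence)
open import Function.Definitions using (Injective)
open import Relation.Binary.PropositionalEquality hiding ([_])
open import Relation.Nullary using (¬_; Dec; yes; no; contradiction; ¬?; _×-dec_; _⊎-dec_)
open import Relation.Nullary.Decidable using (toWitness; fromWitness)

open import Algebra.Properties.CommutativeMonoid.Sum +-0-commutativeMonoid using (sum; sum-permute)

private variable
  m n : ℕ

-- Sums of vectors with one entry changed.

sum-mono-≤ : {f g : Vector ℕ n} → (∀ i → f i ≤ g i) → sum f ≤ sum g
sum-mono-≤ {zero}  f≤g = z≤n
sum-mono-≤ {suc n} f≤g = +-mono-≤ (f≤g zero) (sum-mono-≤ (f≤g ∘ suc))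

sum-updateAt-≤ : ∀ (f : Vector ℕ n) i k →
                 sum (updateAt f i (const k)) ≤ k + sum f
sum-updateAt-≤ {suc n} f zero k = +-monoʳ-≤ k (m≤n+m _ (f zero))
sum-updateAt-≤ {suc n} f (suc i) k = begin
  f zero + sum (updateAt (f ∘ suc) i (const k)) ≤⟨ +-monoʳ-≤ (f zero) (sum-updateAt-≤ (f ∘ suc) i k) ⟩
  f zero + (k + sum (f ∘ suc))                  ≡⟨ +-assoc (f zero) k _ ⟨
  f zero + k + sum (f ∘ suc)                    ≡⟨ cong (_+ sum (f ∘ suc)) (+-comm (f zero) k) ⟩
  k + f zero + sum (f ∘ suc)                    ≡⟨ +-assoc k (f zero) _ ⟩
  k + (f zero + sum (f ∘ suc))                  ∎
  where open ≤-Reasoning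

sum-updateAt-suc : ∀ (f : Vector ℕ n) i → sum (updateAt f i suc) ≡ suc (sum f)
sum-updateAt-suc {suc n} f zero    = refl
sum-updateAt-suc {suc n} f (suc i) =
  trans (cong (f zero +_) (sum-updateAt-suc (f ∘ suc) i)) (+-suc (f zero) _)

lookup≤sum : ∀ (f : Vector ℕ n) i → f i ≤ sum f
lookup≤sum {suc n} f zero    = m≤m+n _ _
lookup≤sum {suc n} f (suc i) = ≤-trans (lookup≤sum (f ∘ suc) i) (m≤n+m _ (f zero))

≤-updateAt-suc : ∀ (f : Vector ℕ n) w v → f v ≤ updateAt f w suc v
≤-updateAt-suc f w v with v ≟ w
... | yes refl = ≤-trans (n≤1+n _) (≤-reflexive (sym (updateAt-updates w f)))
... | no v≢w   = ≤-reflexive (sym (updateAt-minimal v w f v≢w))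

-- Geodesic metrics on a finite vertex set.

another : 2 ≤ n → (b : Fin n) → ∃[ x ] x ≢ b
another (s≤s (s≤s _)) zero    = suc zero , λ ()
another (s≤s (s≤s _)) (suc b) = zero , λ ()

-- The distance of a finite connected graph, separated from its adjacency; `firstStep` is the
-- graph-like property. Intermediate trees can then be handled as metrics alone.
record IsGeodesicMetric (d : Fin n → Fin n → ℕ) : Set where
  field
    d-refl    : ∀ x → d x x ≡ 0
    d≡0⇒≡     : ∀ {x y} → d x y ≡ 0 → x ≡ y
    d-sym     : ∀ x y → d x y ≡ d y x
    triangle  : ∀ x y z → d x z ≤ d x y + d y z
    firstStep : ∀ {x z k} → d x z ≡ suc k → ∃[ y ] (d x y ≡ 1 × d y z ≡ k)

  -- A discrete intermediate value argument: `z` moves towards `x` by first steps, and its distance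
  -- to `x` falls by exactly one each time.
  reaches : ∀ {x z k} → k ≤ d x z → ∃[ y ] d x y ≡ k
  reaches {x} {z} {k} k≤d = go _ refl k≤d
    where
    go : ∀ j {z} → d z x ≡ j → k ≤ d x z → ∃[ y ] d x y ≡ k
    go j {z} eq k≤ with k ℕ.≟ d x z
    ... | yes k≡ = z , sym k≡
    go zero    {z} eq k≤ | no k≢ = contradiction (≤-antisym k≤ (≤-trans (≤-reflexive (trans (d-sym x z) eq)) z≤n)) k≢
    go (suc j) {z} eq k≤ | no k≢ with firstStep eq
    ... | y , _ , dyx = go j dyx (s≤s⁻¹ (begin-strict
        k         <⟨ ≤∧≢⇒< k≤ k≢ ⟩
        d x z     ≡⟨ trans (d-sym x z) eq ⟩
        suc j     ≡⟨ cong suc (trans (sym dyx) (d-sym y x)) ⟩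
        suc (d x y) ∎))
      where open ≤-Reasoning

  d<1⇒≡ : ∀ {x y} → d x y < 1 → x ≡ y
  d<1⇒≡ = d≡0⇒≡ ∘ n<1⇒n≡0

  ≢⇒0<d : ∀ {x y} → x ≢ y → 0 < d x y
  ≢⇒0<d x≢y = n≢0⇒n>0 (x≢y ∘ d≡0⇒≡)

-- Broadcasts over a metric.

module _ (d : Fin n → Fin n → ℕ) (f : Vector ℕ n) where

  HearsFrom : Fin n → Fin n → Set
  HearsFrom x v = 0 < f v × d x v ≤ f v

  Dominating : Set
  Dominating = ∀ x → ∃[ v ] HearsFrom x v

  -- Only broadcasters heard by `x` are constrained: any `u` with `d x u < f u` is heard by `x`
  -- anyway, so the condition on all broadcasters follows.
  Independent : Set
  Independent = ∀ x {v w} → v ≢ w → HearsFrom x v → HearsFrom x w → f v ≤ d x v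

  SharesBoundary : Fin n → Set
  SharesBoundary v = ∃[ x ] (d x v ≤ f v × ∃[ w ] (w ≢ v × HearsFrom x w))

  Unshared : Fin n → Set
  Unshared w = ∀ x v → v ≢ w → HearsFrom x v → f w < d x w

  Saturated : Fin n → Set
  Saturated v = (∀ x → d x v ≤ f v) ⊎ SharesBoundary v

  -- The eccentricity bound, given by a witness instead of a maximum so that it can be followed when
  -- a vertex is deleted.
  Bounded : Fin n → Set
  Bounded v = ∃[ x ] f v ≤ d x v

  -- A local form of maximality; `isMaximalBnIndependent⇒` and `⇒isMaximalBnIndependent` show that
  -- it agrees with the original on connected graphs with at least two vertices.
  record IsMaximal : Set where
    field
      dominating  : Dominating
      independent : Independent
      saturated   : ∀ v → 0 < f v → Saturated v
      bounded     : ∀ v → Bounded v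

  hearsFrom? : ∀ x v → Dec (HearsFrom x v)
  hearsFrom? x v = (0 <? f v) ×-dec (d x v ≤? f v)

  saturated? : ∀ v → Dec (Saturated v)
  saturated? v = all? (λ x → d x v ≤? f v)
    ⊎-dec any? λ x → (d x v ≤? f v) ×-dec any? λ w → ¬? (w ≟ v) ×-dec hearsFrom? x w

≤-hearsFrom : ∀ (d : Fin n → Fin n → ℕ) {f g} → (∀ v → f v ≤ g v) →
  ∀ {x v} → HearsFrom d f x v → HearsFrom d g x v
≤-hearsFrom _ f≤g {v = v} (0<fv , dxv) = ≤-trans 0<fv (f≤g v) , ≤-trans dxv (f≤g v)

-- Repairing strengths that are too small or too large.

module _ {d : Fin n → Fin n → ℕ} (isMetric : IsGeodesicMetric d) where
  open IsGeodesicMetric isMetric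

  ¬saturated⇒ : ∀ {f w} → ¬ Saturated d f w → ∃[ x ] f w < d x w × Unshared d f w
  ¬saturated⇒ {f} {w} ¬sat
    with x , ¬≤ ← ¬∀⟶∃¬ n _ (λ x → d x w ≤? f w) (¬sat ∘ inj₁)
    = x , ≰⇒> ¬≤ , λ _ _ v≢w h → ≰⇒> λ d≤ → ¬sat (inj₂ (_ , d≤ , _ , v≢w , h))

  -- If a vertex at distance f w + 1 from w were interior to v's ball, its neighbour towards w
  -- would lie in both balls.
  raise-independent : ∀ {f w} → Independent d f → Unshared d f w →
    Independent d (updateAt f w suc)
  raise-independent {f} {w} indep unshared x {u} {v} u≢v (0<gu , du) (0<gv , dv)
    with u ≟ w | v ≟ w
  ... | yes refl | yes refl = contradiction refl u≢v
  ... | yes refl | no v≢w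
    rewrite updateAt-updates w {suc} f | updateAt-minimal v w {suc} f v≢w = unshared x v v≢w (0<gv , dv)
  ... | no u≢w | no v≢w
    rewrite updateAt-minimal u w {suc} f u≢w | updateAt-minimal v w {suc} f v≢w =
    indep x u≢v (0<gu , du) (0<gv , dv)
  ... | no u≢w | yes refl
    rewrite updateAt-updates w {suc} f | updateAt-minimal u w {suc} f u≢w = ≮⇒≥ λ dxu<fu →
    let y , dxy≡1 , dyw≡fw = firstStep {x} {w} (≤-antisym dv (unshared x u u≢w (0<gu , du)))
        dyu≤fu = begin
          d y u         ≤⟨ triangle y x u ⟩
          d y x + d x u ≡⟨ cong (_+ d x u) (trans (d-sym y x) dxy≡1) ⟩
          suc (d x u)   ≤⟨ dxu<fu ⟩
          f u           ∎
    in <-irrefl (sym dyw≡fw) (unshared y u u≢w (0<gu , dyu≤fu))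
    where open ≤-Reasoning

  -- Raising w saturates it: a vertex at distance f w + 1 is dominated by some other broadcaster.
  saturateOne : ∀ {f w} → Dominating d f → Independent d f → (∀ v → Bounded d f v) →
    (∀ v → v ≢ w → 0 < f v → Saturated d f v) →
    ∃[ g ] (IsMaximal d g × sum g ≤ suc (sum f))
  saturateOne {f} {w} dom indep bounded sat with saturated? d f w
  ... | yes sat-w = f , record
    { dominating = dom ; independent = indep ; bounded = bounded
    ; saturated = λ v 0<fv → case-≟ v 0<fv (v ≟ w) } , n≤1+n _
    where
    case-≟ : ∀ v → 0 < f v → Dec (v ≡ w) → Saturated d f v
    case-≟ v 0<fv (yes refl) = sat-w
    case-≟ v 0<fv (no v≢w)   = sat v v≢w 0<fv
  ... | no ¬sat with x₀ , fw<dx₀w , unshared ← ¬saturated⇒ {f} ¬sat = g , record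
    { dominating  = λ x → let v , h = dom x in v , ≤-hearsFrom d f≤g h
    ; independent = raise-independent indep unshared
    ; saturated   = λ v → sat-g v (v ≟ w)
    ; bounded     = λ v → bounded-g v (v ≟ w)
    } , ≤-reflexive (sum-updateAt-suc f w)
    where
    g = updateAt f w suc
    f≤g = ≤-updateAt-suc f w
    gw≡ : g w ≡ suc (f w)
    gw≡ = updateAt-updates w f
    sat-g : ∀ v → Dec (v ≡ w) → 0 < g v → Saturated d g v
    sat-g v (no v≢w) 0<gv with sat v v≢w (subst (0 <_) (updateAt-minimal v w f v≢w) 0<gv)
    ... | inj₁ all≤ = inj₁ λ x → ≤-trans (all≤ x) (f≤g v)
    ... | inj₂ (x , dxv , u , u≢v , h) = inj₂ (x , ≤-trans dxv (f≤g v) , u , u≢v , ≤-hearsFrom d f≤g h)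
    sat-g v (yes refl) _
      with y , dwy ← reaches {w} {x₀} (subst (f w <_) (d-sym x₀ w) fw<dx₀w)
      with u , h ← dom y
      = inj₂ (y , ≤-reflexive (trans dyw (sym gw≡)) , u , u≢w , ≤-hearsFrom d f≤g h)
      where
      dyw : d y w ≡ suc (f w)
      dyw = trans (d-sym y w) dwy
      u≢w : u ≢ w
      u≢w refl = 1+n≰n (subst (_≤ f w) dyw (proj₂ h))
    bounded-g : ∀ v → Dec (v ≡ w) → Bounded d g v
    bounded-g v (yes refl) = x₀ , subst (_≤ d x₀ w) (sym gw≡) fw<dx₀w
    bounded-g v (no v≢w) = let x , b = bounded v in x , subst (_≤ d x v) (sym (updateAt-minimal v w f v≢w)) b

  -- Since `y` is farthest from `b`, the strength is the eccentricity of `b`: the ball is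
  -- everything, and a single broadcaster is trivially independent.
  single-isMaximal : ∀ {b y} → 0 < d y b → (∀ x → d x b ≤ d y b) →
    IsMaximal d (updateAt (const 0) b (const (d y b)))
  single-isMaximal {b} {y} 0<k ecc≤k = record
    { dominating  = λ x → b , subst (0 <_) (sym sb≡k) 0<k , subst (d x b ≤_) (sym sb≡k) (ecc≤k x)
    ; independent = λ _ v≢w (0<sv , _) (0<sw , _) → contradiction (trans (only 0<sv) (sym (only 0<sw))) v≢w
    ; saturated   = λ v 0<sv → inj₁ (everything v (only 0<sv))
    ; bounded     = bounded
    }
    where
    s : Vector ℕ n
    s = updateAt (const 0) b (const (d y b))
    sb≡k : s b ≡ d y b
    sb≡k = updateAt-updates b (const 0)
    only : ∀ {v} → 0 < s v → v ≡ b
    only {v} 0<sv with v ≟ b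
    ... | yes v≡b = v≡b
    ... | no v≢b  = contradiction (subst (0 <_) (updateAt-minimal v b (const 0) v≢b) 0<sv) λ ()
    everything : ∀ v → v ≡ b → ∀ x → d x v ≤ s v
    everything v refl x = subst (d x b ≤_) (sym sb≡k) (ecc≤k x)
    bounded : ∀ v → Bounded d s v
    bounded v with v ≟ b
    ... | yes refl = y , ≤-reflexive sb≡k
    ... | no v≢b   = v , ≤-trans (≤-reflexive (updateAt-minimal v b (const 0) v≢b)) z≤n

  -- Deleting a leaf can lower an eccentricity below the strength of some `b`. Then `f b` exceeds
  -- every distance to `b` but is at most `d y b + 1`, so `y` is farthest from `b`, and `b` alone
  -- with the smaller strength `d y b` is maximal.
  truncate : ∀ {f y} → 2 ≤ n → Dominating d f → Independent d f →
    (∀ v → 0 < f v → Saturated d f v) →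
    (∀ v → ¬ Bounded d f v → f v ≤ suc (d y v)) →
    ∃[ g ] (IsMaximal d g × sum g ≤ sum f)
  truncate {f} {y} 2≤n dom indep sat slack with all? (λ v → any? λ x → f v ≤? d x v)
  ... | yes bounded = f , record
    { dominating = dom ; independent = indep ; saturated = sat ; bounded = bounded } , ≤-refl
  ... | no ¬bounded
    with b , ¬bounded-b ← ¬∀⟶∃¬ n _ (λ v → any? λ x → f v ≤? d x v) ¬bounded =
    _ , single-isMaximal {b} {y} 0<k ecc≤k , sum-mono-≤ s≤f
    where
    ecc≤k : ∀ x → d x b ≤ d y b
    ecc≤k x = s≤s⁻¹ (≤-trans (≰⇒> λ le → ¬bounded-b (x , le)) (slack b ¬bounded-b))
    0<k : 0 < d y b
    0<k = let x , x≢b = another 2≤n b in ≤-trans (≢⇒0<d x≢b) (ecc≤k x)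
    s≤f : ∀ v → updateAt (const 0) b (const (d y b)) v ≤ f v
    s≤f v with v ≟ b
    ... | yes refl = ≤-trans (≤-reflexive (updateAt-updates b (const 0))) (<⇒≤ (≰⇒> λ le → ¬bounded-b (y , le)))
    ... | no v≢b   = ≤-trans (≤-reflexive (updateAt-minimal v b (const 0) v≢b)) z≤n

-- Adding a leaf to a metric, and deleting it from a broadcast.

addLeaf : (Fin m → Fin m → ℕ) → Fin m → Fin (suc m) → Fin (suc m) → ℕ
addLeaf d y zero    zero    = 0
addLeaf d y zero    (suc b) = suc (d y b)
addLeaf d y (suc a) zero    = suc (d a y)
addLeaf d y (suc a) (suc b) = d a b

module _ {d : Fin m → Fin m → ℕ} (isMetric : IsGeodesicMetric d) (y : Fin m) where
  open IsGeodesicMetric isMetric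
  private
    D = addLeaf d y

  addLeaf-isMetric : IsGeodesicMetric (addLeaf d y)
  addLeaf-isMetric = record
    { d-refl = D-refl ; d≡0⇒≡ = D≡0⇒≡ ; d-sym = D-sym ; triangle = D-triangle ; firstStep = λ {x} → D-firstStep {x} }
    where
    open ≤-Reasoning
    D-refl : ∀ x → D x x ≡ 0
    D-refl zero    = refl
    D-refl (suc a) = d-refl a
    D≡0⇒≡ : ∀ {x z} → D x z ≡ 0 → x ≡ z
    D≡0⇒≡ {zero}  {zero}  _  = refl
    D≡0⇒≡ {suc a} {suc b} eq = cong suc (d≡0⇒≡ eq)
    D-sym : ∀ x z → D x z ≡ D z x
    D-sym zero    zero    = refl
    D-sym zero    (suc b) = cong suc (d-sym y b)
    D-sym (suc a) zero    = cong suc (d-sym a y)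
    D-sym (suc a) (suc b) = d-sym a b
    D-triangle : ∀ x w z → D x z ≤ D x w + D w z
    D-triangle zero    w       zero    = z≤n
    D-triangle zero    zero    (suc c) = ≤-refl
    D-triangle zero    (suc b) (suc c) = s≤s (triangle y b c)
    D-triangle (suc a) zero    zero    = m≤m+n _ 0
    D-triangle (suc a) (suc b) zero    = begin
      suc (d a y)         ≤⟨ s≤s (triangle a b y) ⟩
      suc (d a b + d b y) ≡⟨ +-suc (d a b) (d b y) ⟨
      d a b + suc (d b y) ∎
    D-triangle (suc a) zero    (suc c) = begin
      d a c                     ≤⟨ triangle a y c ⟩
      d a y + d y c             ≤⟨ +-mono-≤ (n≤1+n _) (n≤1+n _) ⟩
      suc (d a y) + suc (d y c) ∎
    D-triangle (suc a) (suc b) (suc c) = triangle a b c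
    D-firstStep : ∀ {x z k} → D x z ≡ suc k → ∃[ w ] (D x w ≡ 1 × D w z ≡ k)
    D-firstStep {zero}  {suc b} eq = suc y , cong suc (d-refl y) , suc-injective eq
    D-firstStep {suc a} {suc b} eq = let w , aw , wb = firstStep eq in suc w , aw , wb
    -- At distance 1 the leaf itself is the first step; from farther away the step goes towards `y`.
    D-firstStep {suc a} {zero} {zero}  eq = zero , eq , refl
    D-firstStep {suc a} {zero} {suc k} eq =
      let w , aw , wy = firstStep (suc-injective eq) in suc w , aw , cong suc wy

  module _ {f : Vector ℕ (suc m)} (isMaximal : IsMaximal D f) (2≤m : 2 ≤ m) where
    open IsMaximal isMaximal
    open ≤-Reasoning
    open IsGeodesicMetric addLeaf-isMetric using () renaming (triangle to D-triangle)

    -- Any other broadcaster reaches the leaf through `y`, and a broadcasting leaf has strength at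
    -- least 1. This moves witnesses from the deleted leaf to `y`.
    leaf-hears⇒y-hears : ∀ {v} → HearsFrom D f zero v → HearsFrom D f (suc y) v
    leaf-hears⇒y-hears {zero}  (0<f , _)  = 0<f , subst (_≤ f zero) (sym (cong suc (d-refl y))) 0<f
    leaf-hears⇒y-hears {suc b} (0<f , le) = 0<f , ≤-trans (n≤1+n _) le

    -- If both broadcast, `y` hears both, and independence bounds `f (suc y)` by the distance 0 from
    -- `y` to itself.
    leaf-silences-y : 0 < f zero → f (suc y) ≡ 0
    leaf-silences-y 0<f₀ with f (suc y) in eq
    ... | zero  = refl
    ... | suc k = contradiction
      (independent (suc y) (λ ()) (subst (0 <_) (sym eq) (s≤s z≤n) , ≤-trans (≤-reflexive (d-refl y)) z≤n)
        (0<f₀ , subst (_≤ f zero) (sym (cong suc (d-refl y))) 0<f₀))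
      (subst₂ (λ a b → ¬ a ≤ b) (sym eq) (sym (d-refl y)) λ ())

    -- The ball of f around r b, with the leaf deleted, is the ball of g around b.
    transfer : ∀ {g} (r : Fin m → Fin (suc m)) → Injective _≡_ _≡_ r →
      (∀ b → ∃[ δ ] (f (r b) ≡ g b + δ × ∀ x → D (suc x) (r b) ≡ d x b + δ)) →
      (∀ v → 0 < f v → ∃[ b ] (r b ≡ v × 0 < g b)) →
      ∃[ g′ ] (IsMaximal d g′ × sum g′ ≤ sum g)
    transfer {g} r r-inj shift onto = truncate isMetric {g} {y} 2≤m
      dominating′ independent′ saturated′ slack
      where
      ball⇒ : ∀ {x b} → d x b ≤ g b → D (suc x) (r b) ≤ f (r b)
      ball⇒ {x} {b} le = let δ , fr , Dr = shift b in
        subst₂ _≤_ (sym (Dr x)) (sym fr) (+-monoˡ-≤ δ le)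
      ball⇐ : ∀ {x b} → D (suc x) (r b) ≤ f (r b) → d x b ≤ g b
      ball⇐ {x} {b} le = let δ , fr , Dr = shift b in
        +-cancelʳ-≤ δ _ _ (subst₂ _≤_ (Dr x) fr le)
      hears⇒ : ∀ {x b} → HearsFrom d g x b → HearsFrom D f (suc x) (r b)
      hears⇒ {x} {b} (0<g , le) = let δ , fr , _ = shift b in
        subst (0 <_) (sym fr) (≤-trans 0<g (m≤m+n _ δ)) , ball⇒ le
      hears⇐ : ∀ {x v} → HearsFrom D f (suc x) v → ∃[ b ] (r b ≡ v × HearsFrom d g x b)
      hears⇐ {x} {v} (0<f , le) with b , refl , 0<g ← onto v 0<f = b , refl , 0<g , ball⇐ le
      dominating′ : Dominating d g
      dominating′ x = let v , h = dominating (suc x) ; b , _ , h′ = hears⇐ h in b , h′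
      independent′ : Independent d g
      independent′ x {v} v≢w hv hw = let δ , fr , Dr = shift v in
        +-cancelʳ-≤ δ _ _ (subst₂ _≤_ fr (Dr x) (independent (suc x) (v≢w ∘ r-inj) (hears⇒ hv) (hears⇒ hw)))
      shares′ : ∀ {b} x {w} → D (suc x) (r b) ≤ f (r b) → w ≢ r b → HearsFrom D f (suc x) w →
                SharesBoundary d g b
      shares′ x le w≢ h with c , refl , h′ ← hears⇐ h = x , ball⇐ le , c , w≢ ∘ cong r , h′
      saturated′ : ∀ b → 0 < g b → Saturated d g b
      saturated′ b 0<g = case (saturated (r b) 0<fr)
        where
        0<fr : 0 < f (r b)
        0<fr = proj₁ (hears⇒ {b} (0<g , ≤-trans (≤-reflexive (d-refl b)) z≤n))
        case : Saturated D f (r b) → Saturated d g b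
        case (inj₁ all≤) = inj₁ λ x → ball⇐ (all≤ (suc x))
        case (inj₂ (suc x , le , w , w≢ , h)) = inj₂ (shares′ x le w≢ h)
        -- A boundary vertex lost with the leaf is replaced by `y`, which hears both broadcasters as
        -- well.
        case (inj₂ (zero , le , w , w≢ , h)) =
          inj₂ (shares′ y (proj₂ (leaf-hears⇒y-hears (0<fr , le))) w≢ (leaf-hears⇒y-hears h))
      slack : ∀ b → ¬ Bounded d g b → g b ≤ suc (d y b)
      slack b ¬bounded with shift b | bounded (r b)
      ... | δ , fr , Dr | suc x , le = contradiction (x , +-cancelʳ-≤ δ _ _ (subst₂ _≤_ fr (Dr x) le)) ¬bounded
      -- The leaf was the witness for the bound, and it is one step beyond `y`; this is the excess
      -- of 1 that `truncate` tolerates.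
      ... | δ , fr , Dr | zero , le = +-cancelʳ-≤ δ _ _ (begin
        g b + δ                       ≡⟨ fr ⟨
        f (r b)                       ≤⟨ le ⟩
        D zero (r b)                  ≤⟨ D-triangle zero (suc y) (r b) ⟩
        suc (d y y) + D (suc y) (r b) ≡⟨ cong₂ (λ i j → suc (i + j)) (d-refl y) (Dr y) ⟩
        suc (d y b) + δ               ∎)

    silentLeaf : f zero ≡ 0 → ∃[ g ] (IsMaximal d g × sum g ≤ sum f)
    silentLeaf f₀≡0 =
      let g , max , g≤ = transfer {f ∘ suc} suc suc-inj (λ b → 0 , sym (+-identityʳ _) , λ x → sym (+-identityʳ _)) onto
      in g , max , ≤-trans g≤ (m≤n+m _ (f zero))
      where
      suc-inj : Injective _≡_ _≡_ (suc {m})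
      suc-inj refl = refl
      onto : ∀ v → 0 < f v → ∃[ b ] (suc b ≡ v × 0 < f (suc b))
      onto zero    0<f = contradiction (subst (0 <_) f₀≡0 0<f) λ ()
      onto (suc b) 0<f = b , refl , 0<f

    strongLeaf : ∀ {k} → f zero ≡ suc (suc k) → ∃[ g ] (IsMaximal d g × sum g ≤ sum f)
    strongLeaf {k} f₀≡ = let g , max , g≤ = transfer {h} r r-inj shift onto in g , max , (begin
      sum g                        ≤⟨ g≤ ⟩
      sum h                        ≤⟨ sum-updateAt-≤ (f ∘ suc) y (suc k) ⟩
      suc k + sum (f ∘ suc)        ≤⟨ +-monoˡ-≤ _ (≤-trans (n≤1+n _) (≤-reflexive (sym f₀≡))) ⟩
      f zero + sum (f ∘ suc)       ∎)
      where
      h : Vector ℕ m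
      h = updateAt (f ∘ suc) y (const (suc k))
      r : Fin m → Fin (suc m)
      -- `y` inherits the ball of the leaf, where strength and distances both drop by `δ = 1`; every
      -- other vertex keeps its own ball with `δ = 0`.
      r = updateAt suc y (const zero)
      ry : r y ≡ zero
      ry = updateAt-updates y suc
      r≢y : ∀ {b} → b ≢ y → r b ≡ suc b
      r≢y {b} = updateAt-minimal b y suc
      r-inj : Injective _≡_ _≡_ r
      r-inj {a} {b} eq with a ≟ y | b ≟ y
      ... | yes refl | yes refl = refl
      ... | yes refl | no b≢y   = contradiction (trans (sym ry) (trans eq (r≢y b≢y))) λ ()
      ... | no a≢y   | yes refl = contradiction (trans (sym ry) (trans (sym eq) (r≢y a≢y))) λ ()
      ... | no a≢y   | no b≢y   = Fin.suc-injective (trans (sym (r≢y a≢y)) (trans eq (r≢y b≢y)))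
      shift : ∀ b → ∃[ δ ] (f (r b) ≡ h b + δ × ∀ x → D (suc x) (r b) ≡ d x b + δ)
      shift b with b ≟ y
      ... | yes refl rewrite ry | updateAt-updates y {const (suc k)} (f ∘ suc) =
        1 , trans f₀≡ (+-comm 1 (suc k)) , λ x → +-comm 1 (d x y)
      ... | no b≢y rewrite r≢y b≢y | updateAt-minimal b y {const (suc k)} (f ∘ suc) b≢y =
        0 , sym (+-identityʳ _) , λ x → sym (+-identityʳ _)
      onto : ∀ v → 0 < f v → ∃[ b ] (r b ≡ v × 0 < h b)
      onto zero    0<f = y , ry , subst (0 <_) (sym (updateAt-updates y (f ∘ suc))) (s≤s z≤n)
      onto (suc b) 0<f = b , r≢y b≢y , subst (0 <_) (sym (updateAt-minimal b y (f ∘ suc) b≢y)) 0<f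
        where
        b≢y : b ≢ y
        -- `y` is silent next to a broadcasting leaf, so overwriting its strength loses no
        -- broadcaster.
        b≢y refl = contradiction (subst (0 <_) (leaf-silences-y (subst (0 <_) (sym f₀≡) (s≤s z≤n))) 0<f) λ ()

    -- Among the remaining vertices the leaf reaches only `y`, so there is no larger ball to
    -- inherit. Its tasks, dominating `y` and sharing boundaries, pass to `w`.
    weakLeaf : f zero ≡ 1 → ∃[ g ] (IsMaximal d g × sum g ≤ sum f)
    weakLeaf f₀≡1 = fromNeighbour (neighbour (saturated zero 0<f₀))
      where
      0<f₀ : 0 < f zero
      0<f₀ = subst (0 <_) (sym f₀≡1) (s≤s z≤n)
      y-hears-leaf : HearsFrom D f (suc y) zero
      y-hears-leaf = 0<f₀ , subst₂ _≤_ (sym (cong suc (d-refl y))) (sym f₀≡1) ≤-refl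
      hears-leaf⇒≡y : ∀ {x} → D (suc x) zero ≤ f zero → x ≡ y
      hears-leaf⇒≡y {x} le = d<1⇒≡ (subst (suc (d x y) ≤_) f₀≡1 le)
      y-hears : ∀ x {w} → D x zero ≤ f zero → HearsFrom D f x w → HearsFrom D f (suc y) w
      y-hears zero    _  h = leaf-hears⇒y-hears h
      y-hears (suc x) le h with refl ← hears-leaf⇒≡y le = h
      neighbour : Saturated D f zero → ∃[ w ] HearsFrom D f (suc y) (suc w)
      -- A second remaining vertex is out of reach of the leaf, so the leaf must share a boundary
      -- vertex, and its partner there is also heard at `y`.
      neighbour (inj₁ all≤) = let x , x≢y = another 2≤m y in
        contradiction (hears-leaf⇒≡y (all≤ (suc x))) x≢y
      neighbour (inj₂ (x , le , zero , w≢ , h)) = contradiction refl w≢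
      neighbour (inj₂ (x , le , suc w , w≢ , h)) = w , y-hears x le h
      fromNeighbour : ∃[ w ] HearsFrom D f (suc y) (suc w) → ∃[ g ] (IsMaximal d g × sum g ≤ sum f)
      fromNeighbour (w , hw) =
        let g , max , g≤ = saturateOne isMetric {f ∘ suc} {w} dom indep bounded′ sat
        in g , max , ≤-trans g≤ (≤-reflexive (cong (_+ sum (f ∘ suc)) (sym f₀≡1)))
        where
        dom : Dominating d (f ∘ suc)
        dom x with dominating (suc x)
        ... | suc v , h = v , h
        ... | zero , h with refl ← hears-leaf⇒≡y (proj₂ h) = w , hw
        indep : Independent d (f ∘ suc)
        indep x v≢w = independent (suc x) (v≢w ∘ Fin.suc-injective)
        bounded′ : ∀ v → Bounded d (f ∘ suc) v
        bounded′ v with bounded (suc v)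
        ... | suc x , le = x , le
        -- With the leaf as witness the strength is at most `d y v + 1`. Equality would put `y` in
        -- the interior of the ball while `y` also hears the leaf, against independence.
        ... | zero , le with f (suc v) ≤? d y v
        ...   | yes le′ = y , le′
        ...   | no ¬le  = contradiction
          (independent (suc y) (λ ()) (≤-trans (s≤s z≤n) (≰⇒> ¬le) , <⇒≤ (≰⇒> ¬le)) y-hears-leaf) ¬le
        -- The leaf as partner is replaced by `w`, and the leaf as shared vertex by `y`. Since `w`
        -- cannot be its own partner, it is left to `saturateOne`.
        shares : ∀ {v} x {u} → v ≢ w → D x (suc v) ≤ f (suc v) → 0 < f (suc v) → u ≢ suc v →
                 HearsFrom D f x u → SharesBoundary d (f ∘ suc) v
        shares x {zero} v≢w le 0<f u≢ h = y , proj₂ (y-hears x (proj₂ h) (0<f , le)) , w , v≢w ∘ sym , hw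
        shares zero {suc u} v≢w le 0<f u≢ h =
          y , proj₂ (leaf-hears⇒y-hears (0<f , le)) , u , u≢ ∘ cong suc , leaf-hears⇒y-hears h
        shares (suc x) {suc u} v≢w le 0<f u≢ h = x , le , u , u≢ ∘ cong suc , h
        sat : ∀ v → v ≢ w → 0 < f (suc v) → Saturated d (f ∘ suc) v
        sat v v≢w 0<f with saturated (suc v) 0<f
        ... | inj₁ all≤ = inj₁ (all≤ ∘ suc)
        ... | inj₂ (x , le , u , u≢ , h) = inj₂ (shares x v≢w le 0<f u≢ h)

    deleteLeaf : ∃[ g ] (IsMaximal d g × sum g ≤ sum f)
    deleteLeaf = byStrength (f zero) refl
      where
      byStrength : ∀ k → f zero ≡ k → ∃[ g ] (IsMaximal d g × sum g ≤ sum f)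
      byStrength 0             = silentLeaf
      byStrength 1             = weakLeaf
      byStrength (suc (suc k)) = strongLeaf

-- Walks, reachability and graph distance.

-- The search function behind dist is private to Defs. Its name is recovered by unification: abstracting
-- over the size and the start value leaves the unknown applied to distinct variables.
mutual
  searchFrom : ∀ {n} → Graph n → ℕ → ℕ → Fin n → Fin n → ℕ
  searchFrom = _

  dist-unfold : ∀ n (G : Graph (suc n)) u v →
    dist G u v ≡ (if reach G 0 u v then 0 else searchFrom G n 1 u v)
  dist-unfold n with ℕ.suc n | 1
  ... | _ | _ = λ G u v → refl

module _ (G : Graph n) where

  _∷ʳ_ : ∀ {u v w k} → Walk G u v k → adj G v w ≡ true → Walk G u w (suc k)
  here       ∷ʳ e = step e here
  step e′ p  ∷ʳ e = step e′ (p ∷ʳ e)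

  reverse : ∀ {u v k} → Walk G u v k → Walk G v u k
  reverse here                       = here
  reverse (step {u = u} {w = w} e p) = reverse p ∷ʳ trans (adj-sym G w u) e

  concat : ∀ {u v w j k} → Walk G u v j → Walk G v w k → Walk G u w (j + k)
  concat here       q = q
  concat (step e p) q = step e (concat p q)

  reach-sound : ∀ k {u v} → T (reach G k u v) → ∃[ j ] (j ≤ k × Walk G u v j)
  reach-sound zero    t with refl ← toWitness t = 0 , z≤n , here
  reach-sound (suc k) {u} {v} t with Equivalence.to (T-∨ {reach G k u v}) t
  ... | inj₁ t′ = let j , j≤k , p = reach-sound k t′ in j , m≤n⇒m≤1+n j≤k , p
  ... | inj₂ t′
    with w , tw ← Any.satisfied (any⁻ (λ w → reach G k u w ∧ adj G w v) (allFin n) t′)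
    with t₁ , t₂ ← Equivalence.to (T-∧ {reach G k u w}) tw =
    let j , j≤k , p = reach-sound k t₁ in suc j , s≤s j≤k , p ∷ʳ Equivalence.to T-≡ t₂

  reach-mono : ∀ {j k u v} → j ≤ k → T (reach G j u v) → T (reach G k u v)
  reach-mono {j} {k} {u} {v} j≤k t = go (≤⇒≤′ j≤k)
    where
    go : ∀ {k} → j ≤′ k → T (reach G k u v)
    go (≤′-reflexive refl) = t
    go (≤′-step j≤′k)      = Equivalence.from T-∨ (inj₁ (go j≤′k))

  reach-∷ʳ : ∀ {k u w v} → T (reach G k u w) → adj G w v ≡ true → T (reach G (suc k) u v)
  reach-∷ʳ {k} {u} {w} {v} t e = Equivalence.from (T-∨ {reach G k u v}) (inj₂
    (any⁺ (λ w → reach G k u w ∧ adj G w v)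
      (lose (∈-allFin w) (Equivalence.from T-∧ (t , Equivalence.from T-≡ e)))))

  reach-walk : ∀ {j k u w v} → T (reach G j u w) → Walk G w v k → T (reach G (k + j) u v)
  reach-walk         t here       = t
  reach-walk {j} {suc k} {u} {v = v} t (step e p) =
    subst (λ i → T (reach G i u v)) (+-suc k j) (reach-walk (reach-∷ʳ {j} t e) p)

  reach-complete : ∀ {k u v} → Walk G u v k → T (reach G k u v)
  reach-complete {k} {u} {v} p =
    subst (λ i → T (reach G i u v)) (+-identityʳ k) (reach-walk (fromWitness {a? = u ≟ u} refl) p)

  record IsLength (u v : Fin n) (l : ℕ) : Set where
    field
      walk     : Walk G u v l
      shortest : ∀ {k} → Walk G u v k → l ≤ k

  search-isLength : ∀ fuel k {u v N} → Walk G u v N → N ≤ fuel + k →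
    (∀ {j} → Walk G u v j → k ≤ j) → IsLength u v (searchFrom G fuel k u v)
  -- With the fuel exhausted the search returns `k` untested. A walk of length at most `k` exists
  -- and none is shorter than `k`, so the answer is still right.
  search-isLength zero k p N≤k minimal with refl ← ≤-antisym N≤k (minimal p) =
    record { walk = p ; shortest = minimal }
  search-isLength (suc fuel) k {u} {v} p N≤ minimal with reach G k u v in eq
  ... | true = let j , j≤k , q = reach-sound k (Equivalence.from T-≡ eq) in record
    { walk = subst (Walk G u v) (≤-antisym j≤k (minimal q)) q ; shortest = minimal }
  ... | false = search-isLength fuel (suc k) p (≤-trans N≤ (≤-reflexive (sym (+-suc fuel k))))
    λ {j} q → ≰⇒> λ j≤k → subst T eq (reach-mono j≤k (reach-complete q))

  IsDistance : (Fin n → Fin n → ℕ) → Set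
  IsDistance d = ∀ u v → IsLength u v (d u v)

  module IsDistance {d : Fin n → Fin n → ℕ} (isDist : IsDistance d) where

    adj⇒1 : ∀ {u v} → adj G u v ≡ true → d u v ≡ 1
    adj⇒1 {u} {v} e = ≤-antisym (shortest (step e here)) (n≢0⇒n>0 λ d≡0 → distinct (subst (Walk G u v) d≡0 walk))
      where
      open IsLength (isDist u v)
      distinct : ¬ Walk G u v 0
      distinct here with () ← trans (sym e) (adj-irr G u)

    1⇒adj : ∀ {u v} → d u v ≡ 1 → adj G u v ≡ true
    1⇒adj {u} {v} d≡1 with step e here ← subst (Walk G u v) d≡1 (IsLength.walk (isDist u v)) = e

    isGeodesicMetric : IsGeodesicMetric d
    isGeodesicMetric = record
      { d-refl    = λ x → n≤0⇒n≡0 (shortest here)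
      ; d≡0⇒≡     = λ {x} {y} d≡0 → walk₀ (subst (Walk G x y) d≡0 walk)
      ; d-sym     = λ x y → ≤-antisym (shortest (reverse walk)) (shortest (reverse walk))
      ; triangle  = λ x y z → shortest (concat walk walk)
      ; firstStep = λ {x} {z} {k} d≡ → first d≡ (subst (Walk G x z) d≡ walk)
      }
      where
      open module L {u v : Fin n} = IsLength (isDist u v)
      walk₀ : ∀ {x y} → Walk G x y 0 → x ≡ y
      walk₀ here = refl
      first : ∀ {x z k} → d x z ≡ suc k → Walk G x z (suc k) → ∃[ y ] (d x y ≡ 1 × d y z ≡ k)
      first d≡ (step {w = y} e p) = y , adj⇒1 e ,
        ≤-antisym (shortest p) (s≤s⁻¹ (≤-trans (≤-reflexive (sym d≡)) (shortest (step e walk))))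

-- Geodesics as injective paths.

module _ {d : Fin n → Fin n → ℕ} (isMetric : IsGeodesicMetric d) where
  open IsGeodesicMetric isMetric

  geodesic : ∀ {u v} k → d u v ≡ k → Fin (suc k) → Fin n
  geodesic {u} k       eq zero    = u
  geodesic     (suc k) eq (suc i) = geodesic k (proj₂ (proj₂ (firstStep eq))) i

  geodesic-dist : ∀ {u v} k (eq : d u v ≡ k) i → d (geodesic k eq i) v ≡ k ∸ toℕ i
  geodesic-dist k       eq zero    = eq
  geodesic-dist (suc k) eq (suc i) = geodesic-dist k _ i

  -- The distance to `v` drops by one at each index and so tells the vertices apart.
  geodesic-injective : ∀ {u v} k (eq : d u v ≡ k) → Injective _≡_ _≡_ (geodesic k eq)
  geodesic-injective {u} {v} k eq {i} {j} g≡ = toℕ-injective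
    (∸-cancelˡ-≡ (s≤s⁻¹ (toℕ<n i)) (s≤s⁻¹ (toℕ<n j))
      (trans (sym (geodesic-dist k eq i)) (trans (cong (λ x → d x v) g≡) (geodesic-dist k eq j))))

  geodesic-step : ∀ {u v} k (eq : d u v ≡ k) (i : Fin k) →
    d (geodesic k eq (inject₁ i)) (geodesic k eq (suc i)) ≡ 1
  geodesic-step (suc k) eq zero    = proj₁ (proj₂ (firstStep eq))
  geodesic-step (suc k) eq (suc i) = geodesic-step k _ i

  geodesic-last : ∀ {u v} k (eq : d u v ≡ k) → geodesic k eq (fromℕ k) ≡ v
  geodesic-last k eq = d≡0⇒≡ (trans (geodesic-dist k eq (fromℕ k)) (trans (cong (k ∸_) (toℕ-fromℕ k)) (n∸n≡0 k)))

  -- A geodesic of length `d u v` has `d u v + 1` distinct vertices.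
  dist<size : ∀ u v → d u v < n
  dist<size u v = injective⇒≤ (geodesic-injective (d u v) refl)

-- dist searches only up to n; searching up to the length of some walk certainly finds the distance,
-- which is then seen to be below n.
dist-isDistance : ∀ (G : Graph n) → Connected G → IsDistance G (dist G)
dist-isDistance {n} G connected u v = search-isLength G n 0 (IsLength.walk (isDist u v))
  (≤-trans (<⇒≤ (dist<size (IsDistance.isGeodesicMetric G isDist) u v)) (≤-reflexive (sym (+-identityʳ n))))
  λ _ → z≤n
  where
  isDist : IsDistance G λ u v → searchFrom G (proj₁ (connected u v)) 0 u v
  isDist u v = search-isLength G _ 0 (proj₂ (connected u v)) (≤-reflexive (sym (+-identityʳ _))) λ _ → z≤n

-- From broadcasts on graphs to broadcasts over metrics and back.

sum-allFin : ∀ (f : Vector ℕ n) → ListAction.sum (List.map f (allFin n)) ≡ sum f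
sum-allFin f = trans (cong ListAction.sum (map-tabulate (λ i → i) f)) (go f)
  where
  go : ∀ {n} (f : Vector ℕ n) → ListAction.sum (List.tabulate f) ≡ sum f
  go {zero}  f = refl
  go {suc n} f = cong (f zero +_) (go (f ∘ suc))

module _ (G : Graph n) where

  ≤-maxList : ∀ {k l} → k ∈ l → k ≤ maxList G l
  ≤-maxList {l = x ∷ l} (here refl) = m≤m⊔n x _
  ≤-maxList {l = x ∷ l} (there k∈l) = ≤-trans (≤-maxList k∈l) (m≤n⊔m x _)

  -- The empty list has maximum 0 by default without attaining it, hence `0 < k`.
  maxList-attained : ∀ {k} l → 0 < k → k ≤ maxList G l → ∃[ j ] (j ∈ l × k ≤ j)
  maxList-attained []      0<k k≤0 = contradiction (≤-trans 0<k k≤0) λ ()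
  maxList-attained (x ∷ l) 0<k k≤ with ⊔-sel x (maxList G l)
  ... | inj₁ eq = x , here refl , subst (_ ≤_) eq k≤
  ... | inj₂ eq = let j , j∈l , k≤j = maxList-attained l 0<k (subst (_ ≤_) eq k≤) in j , there j∈l , k≤j

  dist≤ecc : ∀ v x → dist G v x ≤ ecc G v
  dist≤ecc v x = ≤-maxList (∈-map⁺ (dist G v) (∈-allFin x))

  ecc≤diam : ∀ v → ecc G v ≤ diam G
  ecc≤diam v = ≤-maxList (∈-map⁺ (ecc G) (∈-allFin v))

  ecc-attained : ∀ v {k} → k ≤ ecc G v → ∃[ x ] k ≤ dist G v x
  ecc-attained v {zero}  _  = v , z≤n
  ecc-attained v {suc k} k≤ with j , j∈ , k≤j ← maxList-attained (List.map (dist G v) (allFin n)) (s≤s z≤n) k≤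
    with x , _ , refl ← ∈-map⁻ (dist G v) j∈ = x , k≤j

  module _ (2≤n : 2 ≤ n) (connected : Connected G) where
    private
      isMetric = IsDistance.isGeodesicMetric G (dist-isDistance G connected)
    open IsGeodesicMetric isMetric

    isBnIndependent⇒ : ∀ {f} → IsBnIndependent G f → Independent (dist G) f × (∀ v → Bounded (dist G) f v)
    isBnIndependent⇒ ((_ , broadcast) , indep) =
      (λ x {v} {w} v≢w hv hw → indep x (v , w , v≢w , hv , hw) v (proj₁ hv)) ,
      λ v → let x , le = ecc-attained v (proj₂ (broadcast 2≤n v)) in x , subst (_ ≤_) (d-sym v x) le

    ⇒isBnIndependent : ∀ {f} → Independent (dist G) f → (∀ v → Bounded (dist G) f v) → IsBnIndependent G f
    ⇒isBnIndependent {f} indep bounded = (n≡1⇒ , λ _ v → ≤-trans (f≤ecc v) (ecc≤diam v) , f≤ecc v) , indep′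
      where
      n≡1⇒ : n ≡ 1 → ∀ v → f v ≡ 1
      n≡1⇒ n≡1 = contradiction (subst (2 ≤_) n≡1 2≤n) λ { (s≤s ()) }
      f≤ecc : ∀ v → f v ≤ ecc G v
      f≤ecc v = let x , le = bounded v in ≤-trans le (≤-trans (≤-reflexive (d-sym x v)) (dist≤ecc v x))
      indep′ : ∀ x → ∃[ v ] ∃[ w ] (v ≢ w × Hears G f x v × Hears G f x w) → ∀ u → 0 < f u → f u ≤ dist G x u
      -- If `x` were interior to the ball of `u`, it would hear `u` too, and `u` differs from `v` or
      -- from `w`.
      indep′ x (v , w , v≢w , hv , hw) u 0<fu with f u ≤? dist G x u
      ... | yes le = le
      ... | no ¬le with u ≟ v
      ...   | yes refl = indep x v≢w hv hw
      ...   | no u≢v   = indep x u≢v (0<fu , <⇒≤ (≰⇒> ¬le)) hv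

    -- Both domination and saturation rest on `unraisable`: where either fails, adding 1 to one
    -- strength gives a larger bn-independent broadcast.
    isMaximalBnIndependent⇒ : ∀ {f} → IsMaximalBnIndependent G f → IsMaximal (dist G) f
    isMaximalBnIndependent⇒ {f} (bn , maximal) with indep , bounded ← isBnIndependent⇒ bn = record
      { dominating = dominating ; independent = indep ; saturated = λ v _ → saturated v ; bounded = bounded }
      where
      unraisable : ∀ {w x} → f w < dist G x w → ¬ Unshared (dist G) f w
      unraisable {w} {x} fw<d unshared = 1+n≢n (trans (sym (updateAt-updates w f))
        (maximal (updateAt f w suc)
          (⇒isBnIndependent (raise-independent isMetric indep unshared) bounded′)
          (≤-updateAt-suc f w) w))
        where
        bounded′ : ∀ v → Bounded (dist G) (updateAt f w suc) v
        bounded′ v with v ≟ w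
        ... | yes refl = x , subst (_≤ dist G x w) (sym (updateAt-updates w f)) fw<d
        ... | no v≢w   = let x , le = bounded v in x , subst (_≤ dist G x v) (sym (updateAt-minimal v w f v≢w)) le
      saturated : ∀ v → Saturated (dist G) f v
      saturated v with saturated? (dist G) f v
      ... | yes sat = sat
      ... | no ¬sat = let _ , lt , unshared = ¬saturated⇒ isMetric ¬sat in contradiction unshared (unraisable lt)
      dominating : Dominating (dist G) f
      dominating x with any? (hearsFrom? (dist G) f x)
      ... | yes h = h
      -- An undominated `x` is silent, and every vertex hearing some broadcaster differs from `x`.
      -- So `x` could be raised to 1, within its eccentricity because of the second vertex `y`.
      ... | no ¬h = contradiction
        (λ z v v≢x h → subst (_< dist G z x) (sym fx≡0) (≢⇒0<d λ { refl → ¬h (v , h) }))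
        (unraisable (subst (_< dist G y x) (sym fx≡0) (≢⇒0<d y≢x)))
        where
        y = proj₁ (another 2≤n x)
        y≢x = proj₂ (another 2≤n x)
        fx≡0 : f x ≡ 0
        fx≡0 = n≤0⇒n≡0 (≮⇒≥ λ 0<fx → ¬h (x , 0<fx , subst (_≤ f x) (sym (d-refl x)) z≤n))

    -- Suppose `g` is larger at `v`. If `v` broadcasts under `f`, then `g v` exceeds the
    -- eccentricity or makes a shared boundary vertex interior. If not, `v` hears a broadcaster of
    -- `f` and, under `g`, also itself at distance 0.
    ⇒isMaximalBnIndependent : ∀ {f} → IsMaximal (dist G) f → IsMaximalBnIndependent G f
    ⇒isMaximalBnIndependent {f} isMaximal = ⇒isBnIndependent independent bounded , maximal
      where
      open IsMaximal isMaximal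
      maximal : ∀ g → IsBnIndependent G g → (∀ v → f v ≤ g v) → ∀ v → g v ≡ f v
      maximal g bn f≤g v = ≤-antisym (≮⇒≥ impossible) (f≤g v)
        where
        indep-g = proj₁ (isBnIndependent⇒ bn)
        bounded-g = proj₂ (isBnIndependent⇒ bn)
        impossible : ¬ f v < g v
        impossible fv<gv with 0 <? f v
        impossible fv<gv | yes 0<fv with saturated v 0<fv
        ... | inj₁ all≤ = let x , le = bounded-g v in <⇒≱ fv<gv (≤-trans le (all≤ x))
        ... | inj₂ (x , dxv , w , w≢v , h) = <⇒≱ fv<gv (≤-trans
          (indep-g x (w≢v ∘ sym) (≤-trans 0<fv (f≤g v) , ≤-trans dxv (f≤g v)) (≤-hearsFrom (dist G) f≤g h)) dxv)
        impossible fv<gv | no ¬0<fv with w , h ← dominating v = <⇒≱ 0<gv (subst (g v ≤_) (d-refl v)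
          (indep-g v (λ { refl → ¬0<fv (proj₁ h) })
            (0<gv , subst (_≤ g v) (sym (d-refl v)) z≤n) (≤-hearsFrom (dist G) f≤g h)))
          where
          0<gv : 0 < g v
          0<gv = ≤-trans (s≤s z≤n) fv<gv

-- Growing an embedded subtree leaf by leaf.

-- For a geodesic d the hypotheses say that φ embeds a connected graph into G; as G is acyclic,
-- an edge of G joining vertices at d-distance at least 2 would close a cycle.
module _ (G : Graph n) (acyclic : ¬ HasCycle G)
  {d : Fin m → Fin m → ℕ} (isMetric : IsGeodesicMetric d)
  {φ : Fin m → Fin n} (φ-inj : Injective _≡_ _≡_ φ)
  (φ-hom : ∀ {a b} → d a b ≡ 1 → adj G (φ a) (φ b) ≡ true) where
  open IsGeodesicMetric isMetric

  adj⇒d≤1 : ∀ {a b} → adj G (φ a) (φ b) ≡ true → d a b ≤ 1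
  adj⇒d≤1 {a} {b} e = go (d a b) refl
    where
    go : ∀ k → d a b ≡ k → k ≤ 1
    go 0 _ = z≤n
    go 1 _ = s≤s z≤n
    go (suc (suc k)) eq = ⊥-elim (acyclic
      (k , φ ∘ c , geodesic-injective isMetric (suc (suc k)) eq ∘ φ-inj ,
        φ-hom ∘ geodesic-step isMetric (suc (suc k)) eq ,
        subst (λ x → adj G (φ x) (φ a) ≡ true) (sym (geodesic-last isMetric (suc (suc k)) eq))
          (trans (adj-sym G (φ b) (φ a)) e)))
      where
      c = geodesic isMetric (suc (suc k)) eq

  module _ {ψ : Fin n → Fin m} (φψ : ∀ t → φ (ψ t) ≡ t) (connected : Connected G) where

    d≤walk : ∀ {s t k} → Walk G s t k → d (ψ s) (ψ t) ≤ k
    d≤walk {s} here = ≤-reflexive (d-refl (ψ s))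
    d≤walk {s} {t} (step {w = w} e p) = ≤-trans (triangle (ψ s) (ψ w) (ψ t)) (+-mono-≤
      (adj⇒d≤1 (trans (cong₂ (adj G) (φψ s) (φψ w)) e)) (d≤walk p))

    walk-d : ∀ {a b} k → d a b ≡ k → Walk G (φ a) (φ b) k
    walk-d zero    eq = subst (λ x → Walk G (φ _) (φ x) 0) (d≡0⇒≡ eq) here
    walk-d (suc k) eq = let w , aw , wb = firstStep eq in step (φ-hom aw) (walk-d k wb)

    ψφ : ∀ a → ψ (φ a) ≡ a
    ψφ a = φ-inj (φψ (φ a))

    -- Geodesics of `d` map to walks of `G`; conversely `φ` is onto, so walks of `G` pull back, each
    -- edge to a step of length at most 1.
    d≡dist : ∀ a b → d a b ≡ dist G (φ a) (φ b)
    d≡dist a b = ≤-antisym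
      (subst₂ (λ x y → d x y ≤ dist G (φ a) (φ b)) (ψφ a) (ψφ b) (d≤walk walk))
      (shortest (walk-d _ refl))
      where open IsLength (dist-isDistance G connected (φ a) (φ b))

    pullback : ∀ {f} → IsMaximal (dist G) f → IsMaximal d (f ∘ φ) × sum (f ∘ φ) ≤ sum f
    pullback {f} isMaximal = record
      { dominating  = λ a → let v , h = dominating (φ a) in ψ v , pull h
      ; independent = λ a v≢w hv hw → subst (f _ ≤_) (sym (d≡dist a _))
          (independent (φ a) (v≢w ∘ φ-inj) (push hv) (push hw))
      ; saturated   = sat
      ; bounded     = λ b → let x , le = bounded (φ b) in ψ x , subst (f (φ b) ≤_) (dψ x b) le
      } , ≤-reflexive (sym (sum-permute f (permutation φ ψ φψ ψφ)))
      where
      open IsMaximal isMaximal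
      dψ : ∀ x b → dist G x (φ b) ≡ d (ψ x) b
      dψ x b = trans (cong (λ y → dist G y (φ b)) (sym (φψ x))) (sym (d≡dist (ψ x) b))
      push : ∀ {a b} → HearsFrom d (f ∘ φ) a b → HearsFrom (dist G) f (φ a) (φ b)
      push {a} {b} (0<f , le) = 0<f , subst (_≤ f (φ b)) (d≡dist a b) le
      pull : ∀ {a v} → HearsFrom (dist G) f (φ a) v → HearsFrom d (f ∘ φ) a (ψ v)
      pull {a} {v} (0<f , le) =
        subst (λ u → 0 < f u) (sym (φψ v)) 0<f ,
        subst₂ _≤_ (trans (cong (dist G (φ a)) (sym (φψ v))) (sym (d≡dist a (ψ v)))) (cong f (sym (φψ v))) le
      sat : ∀ b → 0 < f (φ b) → Saturated d (f ∘ φ) b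
      sat b 0<f with saturated (φ b) 0<f
      ... | inj₁ all≤ = inj₁ λ a → subst (_≤ f (φ b)) (sym (d≡dist a b)) (all≤ (φ a))
      ... | inj₂ (x , le , w , w≢ , h) = inj₂
        (ψ x , subst (_≤ f (φ b)) (dψ x b) le , ψ w , (λ { refl → w≢ (sym (φψ w)) }) ,
          pull (subst (λ y → HearsFrom (dist G) f y w) (sym (φψ x)) h))

-- The edge found is the first one along the walk that leaves the image of `φ`.
boundaryEdge : ∀ (G : Graph n) (φ : Fin m → Fin n) {t k} a → Walk G (φ a) t k → (∀ b → φ b ≢ t) →
  ∃[ b ] ∃[ ℓ ] (adj G (φ b) ℓ ≡ true × (∀ c → φ c ≢ ℓ))
boundaryEdge G φ a here t∉ = contradiction refl (t∉ a)
boundaryEdge G φ a (step {w = w} e p) t∉ with any? (λ b → φ b ≟ w)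
... | yes (b , refl) = boundaryEdge G φ b p t∉
... | no w∉          = a , w , e , λ c φc≡w → w∉ (c , φc≡w)

module _ (G : Graph n) (connected : Connected G) (acyclic : ¬ HasCycle G)
  {f : Vector ℕ n} (isMaximal : IsMaximal (dist G) f) where

  -- The recursion enlarges the subtree by a leaf until it fills `G`, where `f` is pulled back;
  -- leaves are deleted on the way out. `k` bounds the number of missing vertices.
  restrict : ∀ k {m} → n ≤ k + m → 2 ≤ m → {d : Fin m → Fin m → ℕ} → IsGeodesicMetric d →
    (φ : Fin m → Fin n) → Injective _≡_ _≡_ φ → (∀ {a b} → d a b ≡ 1 → adj G (φ a) (φ b) ≡ true) →
    ∃[ g ] (IsMaximal d g × sum g ≤ sum f)
  restrict k {m} n≤ 2≤m {d} isMetric φ φ-inj φ-hom with all? (λ t → any? λ a → φ a ≟ t)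
  ... | yes onto = _ , pullback G acyclic isMetric φ-inj φ-hom (proj₂ ∘ onto) connected isMaximal
  ... | no ¬onto
    with t , t∉ ← ¬∀⟶∃¬ n _ (λ t → any? λ a → φ a ≟ t) ¬onto
    with y , ℓ , e , ℓ∉ ← boundaryEdge G φ (fromℕ< 2≤m) (proj₂ (connected _ t)) (λ b φb≡t → t∉ (b , φb≡t))
    = extend k n≤
    where
    φ⁺ : Fin (suc m) → Fin n
    φ⁺ zero    = ℓ
    φ⁺ (suc a) = φ a
    φ⁺-inj : Injective _≡_ _≡_ φ⁺
    φ⁺-inj {zero}  {zero}  _  = refl
    φ⁺-inj {zero}  {suc b} eq = contradiction (sym eq) (ℓ∉ b)
    φ⁺-inj {suc a} {zero}  eq = contradiction eq (ℓ∉ a)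
    φ⁺-inj {suc a} {suc b} eq = cong suc (φ-inj eq)
    open IsGeodesicMetric isMetric
    -- Distance 1 from the new leaf forces the other vertex to be `y`, so the only new edge required
    -- is `e`.
    φ⁺-hom : ∀ {a b} → addLeaf d y a b ≡ 1 → adj G (φ⁺ a) (φ⁺ b) ≡ true
    φ⁺-hom {zero}  {suc b} eq with refl ← d≡0⇒≡ (suc-injective eq) = trans (adj-sym G ℓ (φ b)) e
    φ⁺-hom {suc a} {zero}  eq with refl ← d≡0⇒≡ (suc-injective eq) = e
    φ⁺-hom {suc a} {suc b} eq = φ-hom eq
    extend : ∀ k → n ≤ k + m → ∃[ g ] (IsMaximal d g × sum g ≤ sum f)
    -- With no vertex missing, `φ⁺` would inject `m + 1` vertices into at most `m`.
    extend zero    n≤ = contradiction (injective⇒≤ φ⁺-inj) (<⇒≱ (s≤s n≤))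
    extend (suc k) n≤ =
      let g⁺ , max⁺ , g⁺≤ = restrict k (≤-trans n≤ (≤-reflexive (sym (+-suc k m)))) (m≤n⇒m≤1+n 2≤m)
            (addLeaf-isMetric isMetric y) φ⁺ φ⁺-inj (λ {a} → φ⁺-hom {a})
          g , max , g≤ = deleteLeaf isMetric y max⁺ 2≤m
      in g , max , ≤-trans g≤ g⁺≤

-- Single vertices and the conclusion.

module _ (G : Graph n) where

  constant₁-isMaximal : n ≡ 1 → IsMaximalBnIndependent G (const 1)
  constant₁-isMaximal refl =
    (((λ _ _ → refl) , λ { (s≤s ()) }) , λ { _ (zero , zero , v≢w , _) → contradiction refl v≢w }) ,
    λ g ((g≡1 , _) , _) _ → g≡1 refl

  -- This settles a one-vertex subtree, whose only broadcast costs 1: a broadcaster exists by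
  -- domination, or by the prescribed value 1 when `n` is 1.
  1≤cost : 1 ≤ n → Connected G → ∀ {f} → IsMaximalBnIndependent G f → 1 ≤ cost G f
  1≤cost 1≤n connected {f} isMaximal = subst (1 ≤_) (sym (sum-allFin f)) (case (m≤n⇒m<n∨m≡n 1≤n))
    where
    positive : ∀ {v} → 0 < f v → 1 ≤ sum f
    positive {v} 0<fv = ≤-trans 0<fv (lookup≤sum f v)
    case : 1 < n ⊎ 1 ≡ n → 1 ≤ sum f
    case (inj₁ 2≤n)  =
      let v , 0<fv , _ = IsMaximal.dominating (isMaximalBnIndependent⇒ G 2≤n connected isMaximal) (fromℕ< 2≤n)
      in positive 0<fv
    case (inj₂ refl) = positive {zero} (≤-reflexive (sym (proj₁ (proj₁ (proj₁ isMaximal)) refl zero)))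

theorem4p2 : ∀ {n m} (T : Graph n) (T′ : Graph m) →
    IsTree T → IsTree T′ →
    (φ : Fin m → Fin n) → Injective _≡_ _≡_ φ →
    (∀ a b → adj T′ a b ≡ true → adj T (φ a) (φ b) ≡ true) →
    ∀ f → IsMaximalBnIndependent T f →
    ∃[ g ] (IsMaximalBnIndependent T′ g × cost T′ g ≤ cost T f)
theorem4p2 {n} {m} T T′ (1≤n , connected , acyclic) (1≤m , connected′ , _) φ φ-inj φ-hom f isMaximal =
  case (m≤n⇒m<n∨m≡n 1≤m)
  where
  case : 1 < m ⊎ 1 ≡ m → ∃[ g ] (IsMaximalBnIndependent T′ g × cost T′ g ≤ cost T f)
  case (inj₂ refl) = const 1 , constant₁-isMaximal T′ refl , 1≤cost T 1≤n connected isMaximal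
  case (inj₁ 2≤m)  =
    let open IsDistance T′ (dist-isDistance T′ connected′)
        2≤n = ≤-trans 2≤m (injective⇒≤ φ-inj)
        g , max , g≤ = restrict T connected acyclic (isMaximalBnIndependent⇒ T 2≤n connected isMaximal)
          -- The crude bound `n` on the number of missing vertices is enough.
          n (m≤m+n n m) 2≤m isGeodesicMetric φ φ-inj (λ d≡1 → φ-hom _ _ (1⇒adj d≡1))
    in g , ⇒isMaximalBnIndependent T′ 2≤m connected′ max ,
      subst₂ _≤_ (sym (sum-allFin g)) (sym (sum-allFin f)) g≤
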